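{- For integers $\nu\ge0$ and $0\le j\le2\nu$, \[\sum_{\mu=0}^\nu\frac{(-1)^\mu}{2(j-\mu)+1}\cdot\frac{(4\nu-2\mu+1)!}{(2(\nu-\mu)+1)!\,(2\nu-\mu)!\,\mu!}=(-1)^j2^{4\nu}\frac{(2\nu-j)!\,j!}{(2(\nu-j))!\,(2j+1)!},\] with the convention $1/m!=0$ for negative integers $m$.
   Context: The multinomial coefficient is written out as $\frac{(4\nu-2\mu+1)!}{(2(\nu-\mu)+1)!(2\nu-\mu)!\mu!}$ (the paper's notation $\binom{4\nu-2\mu+1}{2(\nu-\mu)+1,2\nu-\mu}$). -}

module Defs where

open import Data.Nat as ℕ using (ℕ; zero; suc; _!)
open import Data.Nat.Properties using (_!≢0)
open import Data.Integer as ℤ using (ℤ; +_; -[1+_])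
open import Data.Rational as ℚ using (ℚ; 0ℚ; 1ℚ; _/_)
open import Data.List using (List; map; foldr; upTo)

-- 1 / m!  for an integer m, with the paper's convention 1/m! = 0 for m < 0
invFact : ℤ → ℚ
invFact (+ n)    = (+ 1 / (n !)) {{n !≢0}}
invFact -[1+ n ] = 0ℚ

factℚ : ℕ → ℚ
factℚ n = + (n !) / 1

-- the reciprocal 1 / (2k+1) of the odd integer 2k+1, k ∈ ℤ
-- (k = + n gives 2k+1 = 2n+1; k = -[1+ n] = -(n+1) gives 2k+1 = -(2n+1))
oddRecip : ℤ → ℚ
oddRecip (+ n)    = + 1 / suc (2 ℕ.* n)
oddRecip -[1+ n ] = ℤ.- (+ 1) / suc (2 ℕ.* n)

signPow : ℕ → ℚ
signPow zero    = 1ℚ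
signPow (suc n) = ℚ.- signPow n

twoPow : ℕ → ℚ
twoPow n = + (2 ℕ.^ n) / 1

sumTo : ℕ → (ℕ → ℚ) → ℚ
sumTo ν f = foldr ℚ._+_ 0ℚ (map f (upTo (suc ν)))

multinom : ℕ → ℕ → ℚ
multinom ν μ =
  factℚ (4 ℕ.* ν ℕ.∸ 2 ℕ.* μ ℕ.+ 1)
  ℚ.* invFact (+ 2 ℤ.* (+ ν ℤ.- + μ) ℤ.+ + 1)
  ℚ.* invFact (+ (2 ℕ.* ν) ℤ.- + μ)
  ℚ.* invFact (+ μ)

{-# OPTIONS --safe #-}
-- Write A(ν,μ) for the multinomial, F(ν,j,μ) for the summand, S(ν,j) for the sum and R(ν,j) for the
-- right-hand side.  Creative telescoping (Zeilberger's algorithm) supplies a certificate G with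
--   Q₀ F(ν,j,μ) + Q₁ F(ν,j+1,μ) = G(μ+1) − G(μ),   Q₀ = 2(ν−j)(2ν−2j−1),  Q₁ = 2(2ν−j)(2j+3),
-- so summing over μ gives Q₀ S(ν,j) + Q₁ S(ν,j+1) = 0; the hypergeometric term R satisfies the same
-- recurrence.  A second certificate, in the ν-direction, gives S(ν+1,0) = 16 S(ν,0), hence
-- S(ν,0) = 16^ν = R(ν,0), and since Q₁ ≠ 0 for j < 2ν induction on j yields S = R.  Each certificate
-- identity is verified by rewriting the neighbouring multinomials through the contiguity relations
-- of A in μ and in ν and multiplying out the odd denominators 2x + 1, which leaves a polynomial identity.
module Submission where

open import Data.Nat as ℕ using (ℕ; zero; suc; _!; _≤_)
open import Data.Nat.Properties using (_!≢0)
import Data.Nat.Properties as ℕ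
import Data.Nat.Literals as ℕ
import Data.Nat.Tactic.RingSolver as ℕ-Solver
open import Data.Integer as ℤ using (ℤ; +_; -[1+_])
import Data.Integer.Properties as ℤ
open import Data.Rational as ℚ using (ℚ; _/_; _+_; _*_; -_; _-_; fromℚᵘ)
import Data.Rational.Literals as ℚ
open import Data.Rational.Properties as ℚ using (_≟_; +-*-commutativeRing)
import Data.Rational.Unnormalised as ℚᵘ
import Data.Rational.Unnormalised.Properties as ℚᵘ
open import Data.List.Base using ([]; _∷_; foldr; map; applyUpTo)
open import Data.Maybe.Base using (Maybe; just; nothing)
open import Data.Product.Base using (_,_)
open import Data.Unit.Base using (tt)
open import Agda.Builtin.FromNat using (Number; fromNat)
open import Level using (0ℓ)
open import Relation.Nullary using (yes; no; contradiction)
open import Relation.Binary.PropositionalEquality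
  using (_≡_; refl; sym; trans; cong; cong₂; subst; module ≡-Reasoning)
import Algebra.Properties.Group as GroupProperties
open import Tactic.RingSolver using (solve)
import Tactic.RingSolver.Core.AlmostCommutativeRing as ACR

open import Defs

open GroupProperties ℚ.+-0-group using (∙-cancelˡ; x∙y⁻¹≈ε⇒x≈y)

instance
  ℕ-number : Number ℕ
  ℕ-number = ℕ.number
  ℚ-number : Number ℚ
  ℚ-number = ℚ.number

ℚ-ring : ACR.AlmostCommutativeRing 0ℓ 0ℓ
ℚ-ring = ACR.fromCommutativeRing +-*-commutativeRing isZero
  where
  isZero : ∀ x → Maybe (0 ≡ x)
  isZero x with 0 ≟ x
  ... | yes 0≡x = just 0≡x
  ... | no _    = nothing

cong₃ : ∀ {A B C D : Set} (f : A → B → C → D) {a a′ b b′ c c′} →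
        a ≡ a′ → b ≡ b′ → c ≡ c′ → f a b c ≡ f a′ b′ c′
cong₃ f refl refl refl = refl

compare-cases : ∀ {ℓ} (P : ℕ → ℕ → Set ℓ) →
                (∀ m k → P m (suc (m ℕ.+ k))) → (∀ m → P m m) → (∀ n k → P (suc (n ℕ.+ k)) n) →
                ∀ m n → P m n
compare-cases P less equal greater m n with ℕ.compare m n
... | ℕ.less .m k    = less m k
... | ℕ.equal .m     = equal m
... | ℕ.greater .n k = greater n k

*-cancelˡ-invertible : ∀ {x y} r d → r * d ≡ 1 → d * x ≡ d * y → x ≡ y
*-cancelˡ-invertible {x} {y} r d rd≡1 dx≡dy = begin
  x           ≡⟨ ℚ.*-identityˡ x ⟨
  1 * x       ≡⟨ cong (_* x) rd≡1 ⟨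
  r * d * x   ≡⟨ ℚ.*-assoc r d x ⟩
  r * (d * x) ≡⟨ cong (r *_) dx≡dy ⟩
  r * (d * y) ≡⟨ ℚ.*-assoc r d y ⟨
  r * d * y   ≡⟨ cong (_* y) rd≡1 ⟩
  1 * y       ≡⟨ ℚ.*-identityˡ y ⟩
  y           ∎
  where open ≡-Reasoning

inverse-* : ∀ {r₀ r₁ d₀ d₁} → r₀ * d₀ ≡ 1 → r₁ * d₁ ≡ 1 → (r₀ * r₁) * (d₀ * d₁) ≡ 1
inverse-* {r₀} {r₁} {d₀} {d₁} r₀d₀≡1 r₁d₁≡1 = begin
  (r₀ * r₁) * (d₀ * d₁) ≡⟨ solve (r₀ ∷ r₁ ∷ d₀ ∷ d₁ ∷ []) ℚ-ring ⟩
  (r₀ * d₀) * (r₁ * d₁) ≡⟨ cong₂ _*_ r₀d₀≡1 r₁d₁≡1 ⟩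
  1                     ∎
  where open ≡-Reasoning

[+m+n]-[+m]≡+n : ∀ m n → + (m ℕ.+ n) ℤ.- + m ≡ + n
[+m+n]-[+m]≡+n m n = begin
  + (m ℕ.+ n) ℤ.- + m ≡⟨ ℤ.[+m]-[+n]≡m⊖n (m ℕ.+ n) m ⟩
  (m ℕ.+ n) ℤ.⊖ m     ≡⟨ ℤ.⊖-≥ (ℕ.m≤m+n m n) ⟩
  + (m ℕ.+ n ℕ.∸ m)   ≡⟨ cong +_ (ℕ.m+n∸m≡n m n) ⟩
  + n                 ∎
  where open ≡-Reasoning

[+m]-[+m+1+n]≡-[1+n] : ∀ m n → + m ℤ.- + (m ℕ.+ suc n) ≡ -[1+ n ]
[+m]-[+m+1+n]≡-[1+n] m n = begin
  + m ℤ.- + (m ℕ.+ suc n)   ≡⟨ ℤ.[+m]-[+n]≡m⊖n m (m ℕ.+ suc n) ⟩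
  m ℤ.⊖ (m ℕ.+ suc n)       ≡⟨ ℤ.⊖-< (ℕ.m<m+n m ℕ.z<s) ⟩
  ℤ.- + (m ℕ.+ suc n ℕ.∸ m) ≡⟨ cong (λ x → ℤ.- + x) (ℕ.m+n∸m≡n m (suc n)) ⟩
  -[1+ n ]                  ∎
  where open ≡-Reasoning

[+1+m]-[+1+n]≡[+m]-[+n] : ∀ m n → + suc m ℤ.- + suc n ≡ + m ℤ.- + n
[+1+m]-[+1+n]≡[+m]-[+n] m n = begin
  + suc m ℤ.- + suc n ≡⟨ ℤ.[+m]-[+n]≡m⊖n (suc m) (suc n) ⟩
  suc m ℤ.⊖ suc n     ≡⟨ ℤ.[1+m]⊖[1+n]≡m⊖n m n ⟩
  m ℤ.⊖ n             ≡⟨ ℤ.[+m]-[+n]≡m⊖n m n ⟨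
  + m ℤ.- + n         ∎
  where open ≡-Reasoning

ι : ℤ → ℚ
ι i = i / 1

fromℚᵘ-+ : ∀ p q → fromℚᵘ (p ℚᵘ.+ q) ≡ fromℚᵘ p + fromℚᵘ q
fromℚᵘ-+ p q = ℚ.toℚᵘ-injective (ℚᵘ.≃-trans (ℚ.toℚᵘ-fromℚᵘ (p ℚᵘ.+ q))
  (ℚᵘ.≃-sym (ℚᵘ.≃-trans (ℚ.toℚᵘ-homo-+ (fromℚᵘ p) (fromℚᵘ q))
                         (ℚᵘ.+-cong (ℚ.toℚᵘ-fromℚᵘ p) (ℚ.toℚᵘ-fromℚᵘ q)))))

fromℚᵘ-* : ∀ p q → fromℚᵘ (p ℚᵘ.* q) ≡ fromℚᵘ p * fromℚᵘ q
fromℚᵘ-* p q = ℚ.toℚᵘ-injective (ℚᵘ.≃-trans (ℚ.toℚᵘ-fromℚᵘ (p ℚᵘ.* q))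
  (ℚᵘ.≃-sym (ℚᵘ.≃-trans (ℚ.toℚᵘ-homo-* (fromℚᵘ p) (fromℚᵘ q))
                         (ℚᵘ.*-cong (ℚ.toℚᵘ-fromℚᵘ p) (ℚ.toℚᵘ-fromℚᵘ q)))))

ι-+ : ∀ a b → ι (a ℤ.+ b) ≡ ι a + ι b
ι-+ a b = trans (ℚ.fromℚᵘ-cong {ℚᵘ.mkℚᵘ (a ℤ.+ b) 0} {ℚᵘ.mkℚᵘ a 0 ℚᵘ.+ ℚᵘ.mkℚᵘ b 0}
                                (ℚᵘ.*≡* (cong (ℤ._* + 1) eq)))
                (fromℚᵘ-+ (ℚᵘ.mkℚᵘ a 0) (ℚᵘ.mkℚᵘ b 0))
  where
  eq : a ℤ.+ b ≡ a ℤ.* + 1 ℤ.+ b ℤ.* + 1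
  eq = sym (cong₂ ℤ._+_ (ℤ.*-identityʳ a) (ℤ.*-identityʳ b))

ι-* : ∀ a b → ι (a ℤ.* b) ≡ ι a * ι b
ι-* a b = fromℚᵘ-* (ℚᵘ.mkℚᵘ a 0) (ℚᵘ.mkℚᵘ b 0)

ι-neg : ∀ a → ι (ℤ.- a) ≡ - ι a
ι-neg a = ℚ.toℚᵘ-injective (ℚᵘ.≃-trans (ℚ.toℚᵘ-fromℚᵘ (ℚᵘ.mkℚᵘ (ℤ.- a) 0))
  (ℚᵘ.≃-sym (ℚᵘ.≃-trans (ℚ.toℚᵘ-homo‿- (ι a)) (ℚᵘ.-‿cong (ℚ.toℚᵘ-fromℚᵘ (ℚᵘ.mkℚᵘ a 0))))))

ι-- : ∀ a b → ι (a ℤ.- b) ≡ ι a - ι b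
ι-- a b = trans (ι-+ a (ℤ.- b)) (cong (λ x → ι a + x) (ι-neg b))

ι⁺ : ℕ → ℚ
ι⁺ n = ι (+ n)

ι⁺-+ : ∀ m n → ι⁺ (m ℕ.+ n) ≡ ι⁺ m + ι⁺ n
ι⁺-+ m n = trans (cong ι (ℤ.pos-+ m n)) (ι-+ (+ m) (+ n))

ι⁺-* : ∀ m n → ι⁺ (m ℕ.* n) ≡ ι⁺ m * ι⁺ n
ι⁺-* m n = trans (cong ι (ℤ.pos-* m n)) (ι-* (+ m) (+ n))

ι⁺-suc : ∀ n → ι⁺ (suc n) ≡ ι⁺ n + 1
ι⁺-suc n = trans (ι⁺-+ 1 n) (ℚ.+-comm 1 (ι⁺ n))

ι⁺-linear : ∀ {x} a b c m n → x ≡ a ℕ.* m ℕ.+ b ℕ.* n ℕ.+ c →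
            ι⁺ x ≡ ι⁺ a * ι⁺ m + ι⁺ b * ι⁺ n + ι⁺ c
ι⁺-linear a b c m n refl = begin
  ι⁺ (a ℕ.* m ℕ.+ b ℕ.* n ℕ.+ c)       ≡⟨ ι⁺-+ (a ℕ.* m ℕ.+ b ℕ.* n) c ⟩
  ι⁺ (a ℕ.* m ℕ.+ b ℕ.* n) + ι⁺ c      ≡⟨ cong (_+ ι⁺ c) (ι⁺-+ (a ℕ.* m) (b ℕ.* n)) ⟩
  ι⁺ (a ℕ.* m) + ι⁺ (b ℕ.* n) + ι⁺ c   ≡⟨ cong₂ (λ x y → x + y + ι⁺ c) (ι⁺-* a m) (ι⁺-* b n) ⟩
  ι⁺ a * ι⁺ m + ι⁺ b * ι⁺ n + ι⁺ c     ∎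
  where open ≡-Reasoning

ι⁺-inverse : ∀ n .{{_ : ℕ.NonZero n}} → (+ 1 / n) * ι⁺ n ≡ 1
ι⁺-inverse (suc n) = trans (sym (fromℚᵘ-* (ℚᵘ.mkℚᵘ (+ 1) n) (ℚᵘ.mkℚᵘ (+ suc n) 0)))
                           (ℚ.fromℚᵘ-cong {ℚᵘ.mkℚᵘ (+ 1) n ℚᵘ.* ℚᵘ.mkℚᵘ (+ suc n) 0} {ℚᵘ.mkℚᵘ (+ 1) 0}
                                          (ℚᵘ.*≡* eq))
  where
  eq : (+ 1 ℤ.* + suc n) ℤ.* + 1 ≡ + 1 ℤ.* + (suc n ℕ.* 1)
  eq = begin
    (+ 1 ℤ.* + suc n) ℤ.* + 1 ≡⟨ ℤ.*-identityʳ _ ⟩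
    + 1 ℤ.* + suc n           ≡⟨ cong (λ m → + 1 ℤ.* + m) (sym (ℕ.*-identityʳ (suc n))) ⟩
    + 1 ℤ.* + (suc n ℕ.* 1)   ∎
    where open ≡-Reasoning

oddRecip-inverse : ∀ k → oddRecip k * (2 * ι k + 1) ≡ 1
oddRecip-inverse (+ n) = begin
  oddRecip (+ n) * (2 * ι⁺ n + 1)          ≡⟨ cong (oddRecip (+ n) *_) ⟦2n+1⟧ ⟨
  (+ 1 / suc (2 ℕ.* n)) * ι⁺ (suc (2 ℕ.* n)) ≡⟨ ι⁺-inverse (suc (2 ℕ.* n)) ⟩
  1                                          ∎
  where
  open ≡-Reasoning
  ⟦2n+1⟧ : ι⁺ (suc (2 ℕ.* n)) ≡ 2 * ι⁺ n + 1
  ⟦2n+1⟧ = trans (ι⁺-suc (2 ℕ.* n)) (cong (_+ 1) (ι⁺-* 2 n))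
oddRecip-inverse -[1+ n ] = begin
  - u * (2 * ι (ℤ.- + suc n) + 1)          ≡⟨ cong (λ x → - u * (2 * x + 1)) (trans (ι-neg (+ suc n)) (cong -_ (ι⁺-suc n))) ⟩
  - u * (2 * - (ι⁺ n + 1) + 1)             ≡⟨ flip-signs u (ι⁺ n) ⟩
  u * (2 * ι⁺ n + 1)                       ≡⟨ oddRecip-inverse (+ n) ⟩
  1                                        ∎
  where
  open ≡-Reasoning
  u = + 1 / suc (2 ℕ.* n)
  flip-signs : ∀ u x → - u * (2 * - (x + 1) + 1) ≡ u * (2 * x + 1)
  flip-signs u x = solve (u ∷ x ∷ []) ℚ-ring

oddRecip-difference : ∀ a b → oddRecip (+ a ℤ.- + b) * (2 * (ι⁺ a - ι⁺ b) + 1) ≡ 1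
oddRecip-difference a b =
  trans (cong (λ x → oddRecip (+ a ℤ.- + b) * (2 * x + 1)) (sym (ι-- (+ a) (+ b))))
        (oddRecip-inverse (+ a ℤ.- + b))

factℚ-suc : ∀ m → factℚ (suc m) ≡ (ι⁺ m + 1) * factℚ m
factℚ-suc m = trans (ι⁺-* (suc m) (m !)) (cong (_* factℚ m) (ι⁺-suc m))

factℚ*invFact : ∀ m → factℚ m * invFact (+ m) ≡ 1
factℚ*invFact m = trans (ℚ.*-comm (factℚ m) (invFact (+ m))) (ι⁺-inverse (m !) {{m !≢0}})

invFact-suc : ∀ m → invFact (+ m) ≡ (ι⁺ m + 1) * invFact (+ suc m)
invFact-suc m = begin
  I                   ≡⟨ ℚ.*-identityʳ I ⟨
  I * 1               ≡⟨ cong (I *_) (trans (cong (_* I′) (sym (factℚ-suc m))) (factℚ*invFact (suc m))) ⟨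
  I * ((c * F) * I′)  ≡⟨ regroup I I′ F c ⟩
  (c * I′) * (F * I)  ≡⟨ cong ((c * I′) *_) (factℚ*invFact m) ⟩
  (c * I′) * 1        ≡⟨ ℚ.*-identityʳ (c * I′) ⟩
  c * I′              ∎
  where
  open ≡-Reasoning
  I = invFact (+ m)
  I′ = invFact (+ suc m)
  F = factℚ m
  c = ι⁺ m + 1
  regroup : ∀ I I′ F c → I * ((c * F) * I′) ≡ (c * I′) * (F * I)
  regroup I I′ F c = solve (I ∷ I′ ∷ F ∷ c ∷ []) ℚ-ring

factℚ-suc² : ∀ m → factℚ (suc (suc m)) ≡ (ι⁺ m + 2) * (ι⁺ m + 1) * factℚ m
factℚ-suc² m = begin
  factℚ (suc (suc m))                     ≡⟨ factℚ-suc (suc m) ⟩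
  (ι⁺ (suc m) + 1) * factℚ (suc m)        ≡⟨ cong₂ (λ x y → (x + 1) * y) (ι⁺-suc m) (factℚ-suc m) ⟩
  (ι⁺ m + 1 + 1) * ((ι⁺ m + 1) * factℚ m) ≡⟨ regroup (ι⁺ m) (factℚ m) ⟩
  (ι⁺ m + 2) * (ι⁺ m + 1) * factℚ m       ∎
  where
  open ≡-Reasoning
  regroup : ∀ x F → (x + 1 + 1) * ((x + 1) * F) ≡ (x + 2) * (x + 1) * F
  regroup x F = solve (x ∷ F ∷ []) ℚ-ring

invFact-suc² : ∀ m → invFact (+ m) ≡ (ι⁺ m + 1) * (ι⁺ m + 2) * invFact (+ suc (suc m))
invFact-suc² m = begin
  invFact (+ m)                                     ≡⟨ invFact-suc m ⟩
  (ι⁺ m + 1) * invFact (+ suc m)                    ≡⟨ cong ((ι⁺ m + 1) *_) (invFact-suc (suc m)) ⟩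
  (ι⁺ m + 1) * ((ι⁺ (suc m) + 1) * I)               ≡⟨ cong (λ x → (ι⁺ m + 1) * ((x + 1) * I)) (ι⁺-suc m) ⟩
  (ι⁺ m + 1) * ((ι⁺ m + 1 + 1) * I)                 ≡⟨ regroup (ι⁺ m) I ⟩
  (ι⁺ m + 1) * (ι⁺ m + 2) * I                       ∎
  where
  open ≡-Reasoning
  I = invFact (+ suc (suc m))
  regroup : ∀ x I → (x + 1) * ((x + 1 + 1) * I) ≡ (x + 1) * (x + 2) * I
  regroup x I = solve (x ∷ I ∷ []) ℚ-ring

∑ : ℕ → (ℕ → ℚ) → ℚ
∑ zero    f = 0
∑ (suc n) f = ∑ n f + f n

∑-head : ∀ n f → ∑ (suc n) f ≡ f 0 + ∑ n (λ i → f (suc i))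
∑-head zero    f = ℚ.+-comm 0 (f 0)
∑-head (suc n) f = trans (cong (_+ f (suc n)) (∑-head n f))
                             (ℚ.+-assoc (f 0) (∑ n (λ i → f (suc i))) (f (suc n)))

foldr-applyUpTo≡∑ : ∀ n (g : ℕ → ℕ) (f : ℕ → ℚ) →
                    foldr _+_ 0 (map f (applyUpTo g n)) ≡ ∑ n (λ i → f (g i))
foldr-applyUpTo≡∑ zero    g f = refl
foldr-applyUpTo≡∑ (suc n) g f = trans (cong (λ x → f (g 0) + x) (foldr-applyUpTo≡∑ n (λ i → g (suc i)) f))
                                      (sym (∑-head n (λ i → f (g i))))

sumTo≡∑ : ∀ n f → sumTo n f ≡ ∑ (suc n) f
sumTo≡∑ n = foldr-applyUpTo≡∑ (suc n) (λ i → i)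

∑-telescoping : ∀ n {a b : ℚ} {F F′ G : ℕ → ℚ} →
                (∀ μ → μ ℕ.< n → a * F μ + b * F′ μ ≡ G (suc μ) - G μ) →
                a * ∑ n F + b * ∑ n F′ ≡ G n - G 0
∑-telescoping zero    {a} {b} {G = G} _ = both-sides-vanish a b (G 0)
  where
  both-sides-vanish : ∀ a b g → a * 0 + b * 0 ≡ g - g
  both-sides-vanish a b g = solve (a ∷ b ∷ g ∷ []) ℚ-ring
∑-telescoping (suc n) {a} {b} {F} {F′} {G} step = begin
  a * (∑ n F + F n) + b * (∑ n F′ + F′ n)            ≡⟨ regroup a b (∑ n F) (F n) (∑ n F′) (F′ n) ⟩
  (a * ∑ n F + b * ∑ n F′) + (a * F n + b * F′ n)
    ≡⟨ cong₂ _+_ (∑-telescoping n {a} {b} {F} {F′} {G} (λ μ μ<n → step μ (ℕ.m<n⇒m<1+n μ<n))) (step n ℕ.≤-refl) ⟩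
  (G n - G 0) + (G (suc n) - G n)                    ≡⟨ cancel (G 0) (G n) (G (suc n)) ⟩
  G (suc n) - G 0                                    ∎
  where
  open ≡-Reasoning
  regroup : ∀ a b x y x′ y′ → a * (x + y) + b * (x′ + y′) ≡ (a * x + b * x′) + (a * y + b * y′)
  regroup a b x y x′ y′ = solve (a ∷ b ∷ x ∷ y ∷ x′ ∷ y′ ∷ []) ℚ-ring
  cancel : ∀ g₀ gₙ g₁₊ₙ → (gₙ - g₀) + (g₁₊ₙ - gₙ) ≡ g₁₊ₙ - g₀
  cancel g₀ gₙ g₁₊ₙ = solve (g₀ ∷ gₙ ∷ g₁₊ₙ ∷ []) ℚ-ring

multinom-unfold : ∀ μ k → multinom (μ ℕ.+ k) μ ≡
  factℚ (2 ℕ.* μ ℕ.+ 4 ℕ.* k ℕ.+ 1) * invFact (+ (2 ℕ.* k ℕ.+ 1)) * invFact (+ (μ ℕ.+ 2 ℕ.* k)) * invFact (+ μ)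
multinom-unfold μ k = cong₃ (λ x y z → factℚ x * invFact y * invFact z * invFact (+ μ)) numerator first-denominator second-denominator
  where
  numerator : 4 ℕ.* (μ ℕ.+ k) ℕ.∸ 2 ℕ.* μ ℕ.+ 1 ≡ 2 ℕ.* μ ℕ.+ 4 ℕ.* k ℕ.+ 1
  numerator = cong (ℕ._+ 1) (trans (cong (ℕ._∸ 2 ℕ.* μ) (split μ k)) (ℕ.m+n∸m≡n (2 ℕ.* μ) (2 ℕ.* μ ℕ.+ 4 ℕ.* k)))
    where
    split : ∀ μ k → 4 ℕ.* (μ ℕ.+ k) ≡ 2 ℕ.* μ ℕ.+ (2 ℕ.* μ ℕ.+ 4 ℕ.* k)
    split = ℕ-Solver.solve-∀
  first-denominator : + 2 ℤ.* (+ (μ ℕ.+ k) ℤ.- + μ) ℤ.+ + 1 ≡ + (2 ℕ.* k ℕ.+ 1)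
  first-denominator = trans (cong (λ x → + 2 ℤ.* x ℤ.+ + 1) ([+m+n]-[+m]≡+n μ k)) (cong (ℤ._+ + 1) (sym (ℤ.pos-* 2 k)))
  second-denominator : + (2 ℕ.* (μ ℕ.+ k)) ℤ.- + μ ≡ + (μ ℕ.+ 2 ℕ.* k)
  second-denominator = trans (cong (λ x → + x ℤ.- + μ) (split μ k)) ([+m+n]-[+m]≡+n μ (μ ℕ.+ 2 ℕ.* k))
    where
    split : ∀ μ k → 2 ℕ.* (μ ℕ.+ k) ≡ μ ℕ.+ (μ ℕ.+ 2 ℕ.* k)
    split = ℕ-Solver.solve-∀

multinom-beyond : ∀ ν → multinom ν (suc ν) ≡ 0
multinom-beyond ν = trans (cong (λ x → F * invFact (+ 2 ℤ.* x ℤ.+ + 1) * I * I′) ν-[1+ν]≡-1) (absorb F I I′)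
  where
  F = factℚ (4 ℕ.* ν ℕ.∸ 2 ℕ.* suc ν ℕ.+ 1)
  I = invFact (+ (2 ℕ.* ν) ℤ.- + suc ν)
  I′ = invFact (+ suc ν)
  ν-[1+ν]≡-1 : + ν ℤ.- + suc ν ≡ -[1+ 0 ]
  ν-[1+ν]≡-1 = trans (cong (λ x → + ν ℤ.- + x) (ℕ.+-comm 1 ν)) ([+m]-[+m+1+n]≡-[1+n] ν 0)
  absorb : ∀ x y z → x * 0 * y * z ≡ 0
  absorb x y z = solve (x ∷ y ∷ z ∷ []) ℚ-ring

-- The ratios A(ν,μ+1)/A(ν,μ) and A(ν+1,μ)/A(ν,μ), cross-multiplied so that they stay valid at
-- the boundary (μ = ν, resp. μ = ν + 1), where both sides vanish.
MultinomStepInμ : ℕ → ℕ → Set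
MultinomStepInμ ν μ = (2 * (ι⁺ ν - ι⁺ μ) + 1) * (ι⁺ ν - ι⁺ μ) * multinom ν μ
                    ≡ (ι⁺ μ + 1) * (4 * ι⁺ ν - 2 * ι⁺ μ + 1) * multinom ν (suc μ)

MultinomStepInν : ℕ → ℕ → Set
MultinomStepInν ν μ = 2 * (4 * ι⁺ ν - 2 * ι⁺ μ + 5) * (4 * ι⁺ ν - 2 * ι⁺ μ + 3) * multinom ν μ
                    ≡ (2 * (ι⁺ ν - ι⁺ μ) + 3) * (ι⁺ ν - ι⁺ μ + 1) * multinom (suc ν) μ

module MultinomNeighboursInμ (μ k : ℕ) where

  private
    M = ι⁺ μ
    K = ι⁺ k

    f = 2 ℕ.* suc μ ℕ.+ 4 ℕ.* k ℕ.+ 1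
    X = factℚ f
    Ia = invFact (+ suc (suc (2 ℕ.* k ℕ.+ 1)))
    Ib = invFact (+ suc (suc μ ℕ.+ 2 ℕ.* k))
    Iμ = invFact (+ suc μ)

  common : ℚ
  common = X * Ia * Ib * Iμ

  lower : multinom (suc (μ ℕ.+ k)) μ ≡ (2 * M + 4 * K + 5) * (2 * M + 4 * K + 4) * (M + 1) * common
  lower = begin
    multinom (suc (μ ℕ.+ k)) μ
      ≡⟨ cong (λ n → multinom n μ) (ℕ.+-suc μ k) ⟨
    multinom (μ ℕ.+ suc k) μ
      ≡⟨ multinom-unfold μ (suc k) ⟩
    factℚ (2 ℕ.* μ ℕ.+ 4 ℕ.* suc k ℕ.+ 1) * invFact (+ (2 ℕ.* suc k ℕ.+ 1)) * invFact (+ (μ ℕ.+ 2 ℕ.* suc k)) * invFact (+ μ)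
      ≡⟨ cong₃ (λ x y z → factℚ x * invFact (+ y) * invFact (+ z) * invFact (+ μ))
               (numerator-shift μ k) (first-denominator-shift k) (second-denominator-shift μ k) ⟩
    factℚ (suc (suc f)) * Ia * Ib * invFact (+ μ)
      ≡⟨ cong₂ (λ x y → x * Ia * Ib * y) (factℚ-suc² f) (invFact-suc μ) ⟩
    (ι⁺ f + 2) * (ι⁺ f + 1) * factℚ f * Ia * Ib * ((M + 1) * invFact (+ suc μ))
      ≡⟨ cong (λ x → (x + 2) * (x + 1) * factℚ f * Ia * Ib * ((M + 1) * invFact (+ suc μ))) ⟦f⟧ ⟩
    (2 * M + 4 * K + 3 + 2) * (2 * M + 4 * K + 3 + 1) * factℚ f * Ia * Ib * ((M + 1) * invFact (+ suc μ))
      ≡⟨ regroup M K (factℚ f) Ia Ib (invFact (+ suc μ)) ⟩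
    (2 * M + 4 * K + 5) * (2 * M + 4 * K + 4) * (M + 1) * common
      ∎
    where
    open ≡-Reasoning
    ⟦f⟧ : ι⁺ (2 ℕ.* suc μ ℕ.+ 4 ℕ.* k ℕ.+ 1) ≡ 2 * M + 4 * K + 3
    ⟦f⟧ = ι⁺-linear 2 4 3 μ k (normal-form μ k)
      where
      normal-form : ∀ μ k → 2 ℕ.* suc μ ℕ.+ 4 ℕ.* k ℕ.+ 1 ≡ 2 ℕ.* μ ℕ.+ 4 ℕ.* k ℕ.+ 3
      normal-form = ℕ-Solver.solve-∀
    numerator-shift : ∀ μ k → 2 ℕ.* μ ℕ.+ 4 ℕ.* suc k ℕ.+ 1 ≡ suc (suc (2 ℕ.* suc μ ℕ.+ 4 ℕ.* k ℕ.+ 1))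
    numerator-shift = ℕ-Solver.solve-∀
    first-denominator-shift : ∀ k → 2 ℕ.* suc k ℕ.+ 1 ≡ suc (suc (2 ℕ.* k ℕ.+ 1))
    first-denominator-shift = ℕ-Solver.solve-∀
    second-denominator-shift : ∀ μ k → μ ℕ.+ 2 ℕ.* suc k ≡ suc (suc μ ℕ.+ 2 ℕ.* k)
    second-denominator-shift = ℕ-Solver.solve-∀
    regroup : ∀ M K X Ia Ib Iμ →
      (2 * M + 4 * K + 3 + 2) * (2 * M + 4 * K + 3 + 1) * X * Ia * Ib * ((M + 1) * Iμ)
        ≡ (2 * M + 4 * K + 5) * (2 * M + 4 * K + 4) * (M + 1) * (X * Ia * Ib * Iμ)
    regroup M K X Ia Ib Iμ = solve (M ∷ K ∷ X ∷ Ia ∷ Ib ∷ Iμ ∷ []) ℚ-ring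

  upper : multinom (suc (μ ℕ.+ k)) (suc μ) ≡ (2 * K + 2) * (2 * K + 3) * (M + 2 * K + 2) * common
  upper = begin
    multinom (suc μ ℕ.+ k) (suc μ)
      ≡⟨ multinom-unfold (suc μ) k ⟩
    X * invFact (+ (2 ℕ.* k ℕ.+ 1)) * invFact (+ (suc μ ℕ.+ 2 ℕ.* k)) * Iμ
      ≡⟨ cong₂ (λ x y → X * x * y * Iμ) (invFact-suc² (2 ℕ.* k ℕ.+ 1)) (invFact-suc (suc μ ℕ.+ 2 ℕ.* k)) ⟩
    X * ((ι⁺ (2 ℕ.* k ℕ.+ 1) + 1) * (ι⁺ (2 ℕ.* k ℕ.+ 1) + 2) * Ia) * ((ι⁺ (suc μ ℕ.+ 2 ℕ.* k) + 1) * Ib) * Iμ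
      ≡⟨ cong₂ (λ x y → X * ((x + 1) * (x + 2) * Ia) * ((y + 1) * Ib) * Iμ) ⟦a⟧ ⟦b⟧ ⟩
    X * ((2 * K + 1 + 1) * (2 * K + 1 + 2) * Ia) * ((M + 2 * K + 1 + 1) * Ib) * Iμ
      ≡⟨ regroup M K X Ia Ib Iμ ⟩
    (2 * K + 2) * (2 * K + 3) * (M + 2 * K + 2) * common
      ∎
    where
    open ≡-Reasoning
    ⟦a⟧ : ι⁺ (2 ℕ.* k ℕ.+ 1) ≡ 2 * K + 1
    ⟦a⟧ = trans (ι⁺-+ (2 ℕ.* k) 1) (cong (_+ 1) (ι⁺-* 2 k))
    ⟦b⟧ : ι⁺ (suc μ ℕ.+ 2 ℕ.* k) ≡ M + 2 * K + 1
    ⟦b⟧ = trans (ι⁺-suc (μ ℕ.+ 2 ℕ.* k)) (cong (_+ 1) (trans (ι⁺-+ μ (2 ℕ.* k)) (cong (λ x → M + x) (ι⁺-* 2 k))))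
    regroup : ∀ M K X Ia Ib Iμ →
      X * ((2 * K + 1 + 1) * (2 * K + 1 + 2) * Ia) * ((M + 2 * K + 1 + 1) * Ib) * Iμ
        ≡ (2 * K + 2) * (2 * K + 3) * (M + 2 * K + 2) * (X * Ia * Ib * Iμ)
    regroup M K X Ia Ib Iμ = solve (M ∷ K ∷ X ∷ Ia ∷ Ib ∷ Iμ ∷ []) ℚ-ring

  step : MultinomStepInμ (suc (μ ℕ.+ k)) μ
  step = begin
    (2 * (ι⁺ (suc (μ ℕ.+ k)) - M) + 1) * (ι⁺ (suc (μ ℕ.+ k)) - M) * multinom (suc (μ ℕ.+ k)) μ
      ≡⟨ cong₂ (λ N A → (2 * (N - M) + 1) * (N - M) * A) ⟦ν⟧ lower ⟩
    (2 * (M + K + 1 - M) + 1) * (M + K + 1 - M) * ((2 * M + 4 * K + 5) * (2 * M + 4 * K + 4) * (M + 1) * common)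
      ≡⟨ identity M K common ⟩
    (M + 1) * (4 * (M + K + 1) - 2 * M + 1) * ((2 * K + 2) * (2 * K + 3) * (M + 2 * K + 2) * common)
      ≡⟨ cong₂ (λ N C → (M + 1) * (4 * N - 2 * M + 1) * C) ⟦ν⟧ upper ⟨
    (M + 1) * (4 * ι⁺ (suc (μ ℕ.+ k)) - 2 * M + 1) * multinom (suc (μ ℕ.+ k)) (suc μ)
      ∎
    where
    open ≡-Reasoning
    ⟦ν⟧ : ι⁺ (suc (μ ℕ.+ k)) ≡ M + K + 1
    ⟦ν⟧ = trans (ι⁺-suc (μ ℕ.+ k)) (cong (_+ 1) (ι⁺-+ μ k))
    identity : ∀ M K W →
      (2 * (M + K + 1 - M) + 1) * (M + K + 1 - M) * ((2 * M + 4 * K + 5) * (2 * M + 4 * K + 4) * (M + 1) * W)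
        ≡ (M + 1) * (4 * (M + K + 1) - 2 * M + 1) * ((2 * K + 2) * (2 * K + 3) * (M + 2 * K + 2) * W)
    identity M K W = solve (M ∷ K ∷ W ∷ []) ℚ-ring

multinom-step-μ-at-top : ∀ ν → MultinomStepInμ ν ν
multinom-step-μ-at-top ν = begin
  (2 * (N - N) + 1) * (N - N) * multinom ν ν         ≡⟨ vanishing N (multinom ν ν) ⟩
  0                                                  ≡⟨ ℚ.*-zeroʳ c ⟨
  c * 0                                              ≡⟨ cong (c *_) (multinom-beyond ν) ⟨
  c * multinom ν (suc ν)                             ∎
  where
  open ≡-Reasoning
  N = ι⁺ ν
  c = (N + 1) * (4 * N - 2 * N + 1)
  vanishing : ∀ N A → (2 * (N - N) + 1) * (N - N) * A ≡ 0
  vanishing N A = solve (N ∷ A ∷ []) ℚ-ring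

multinom-step-μ : ∀ ν μ → μ ℕ.≤ ν → MultinomStepInμ ν μ
multinom-step-μ ν μ μ≤ν =
  compare-cases (λ μ ν → μ ℕ.≤ ν → MultinomStepInμ ν μ)
    (λ μ k _ → MultinomNeighboursInμ.step μ k)
    (λ μ _ → multinom-step-μ-at-top μ)
    (λ ν k μ≤ν → contradiction μ≤ν (ℕ.<⇒≱ (ℕ.s≤s (ℕ.m≤m+n ν k))))
    μ ν μ≤ν

module MultinomNeighboursInν (μ k : ℕ) where

  private
    M = ι⁺ μ
    K = ι⁺ k
    f = 2 ℕ.* μ ℕ.+ 4 ℕ.* k ℕ.+ 1
    X = factℚ f
    Ia = invFact (+ suc (suc (2 ℕ.* k ℕ.+ 1)))
    Ib = invFact (+ suc (suc (μ ℕ.+ 2 ℕ.* k)))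
    Iμ = invFact (+ μ)

  common : ℚ
  common = X * Ia * Ib * Iμ

  lower : multinom (μ ℕ.+ k) μ ≡ (2 * K + 2) * (2 * K + 3) * (M + 2 * K + 1) * (M + 2 * K + 2) * common
  lower = begin
    multinom (μ ℕ.+ k) μ
      ≡⟨ multinom-unfold μ k ⟩
    X * invFact (+ (2 ℕ.* k ℕ.+ 1)) * invFact (+ (μ ℕ.+ 2 ℕ.* k)) * Iμ
      ≡⟨ cong₂ (λ x y → X * x * y * Iμ) (invFact-suc² (2 ℕ.* k ℕ.+ 1)) (invFact-suc² (μ ℕ.+ 2 ℕ.* k)) ⟩
    X * ((ι⁺ (2 ℕ.* k ℕ.+ 1) + 1) * (ι⁺ (2 ℕ.* k ℕ.+ 1) + 2) * Ia)
      * ((ι⁺ (μ ℕ.+ 2 ℕ.* k) + 1) * (ι⁺ (μ ℕ.+ 2 ℕ.* k) + 2) * Ib) * Iμ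
      ≡⟨ cong₂ (λ x y → X * ((x + 1) * (x + 2) * Ia) * ((y + 1) * (y + 2) * Ib) * Iμ) ⟦a⟧ ⟦b⟧ ⟩
    X * ((2 * K + 1 + 1) * (2 * K + 1 + 2) * Ia) * ((M + 2 * K + 1) * (M + 2 * K + 2) * Ib) * Iμ
      ≡⟨ regroup M K X Ia Ib Iμ ⟩
    (2 * K + 2) * (2 * K + 3) * (M + 2 * K + 1) * (M + 2 * K + 2) * common
      ∎
    where
    open ≡-Reasoning
    ⟦a⟧ : ι⁺ (2 ℕ.* k ℕ.+ 1) ≡ 2 * K + 1
    ⟦a⟧ = trans (ι⁺-+ (2 ℕ.* k) 1) (cong (_+ 1) (ι⁺-* 2 k))
    ⟦b⟧ : ι⁺ (μ ℕ.+ 2 ℕ.* k) ≡ M + 2 * K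
    ⟦b⟧ = trans (ι⁺-+ μ (2 ℕ.* k)) (cong (λ x → M + x) (ι⁺-* 2 k))
    regroup : ∀ M K X Ia Ib Iμ →
      X * ((2 * K + 1 + 1) * (2 * K + 1 + 2) * Ia) * ((M + 2 * K + 1) * (M + 2 * K + 2) * Ib) * Iμ
        ≡ (2 * K + 2) * (2 * K + 3) * (M + 2 * K + 1) * (M + 2 * K + 2) * (X * Ia * Ib * Iμ)
    regroup M K X Ia Ib Iμ = solve (M ∷ K ∷ X ∷ Ia ∷ Ib ∷ Iμ ∷ []) ℚ-ring

  upper : multinom (suc (μ ℕ.+ k)) μ
            ≡ (2 * M + 4 * K + 5) * (2 * M + 4 * K + 4) * (2 * M + 4 * K + 3) * (2 * M + 4 * K + 2) * common
  upper = begin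
    multinom (suc (μ ℕ.+ k)) μ
      ≡⟨ cong (λ n → multinom n μ) (ℕ.+-suc μ k) ⟨
    multinom (μ ℕ.+ suc k) μ
      ≡⟨ multinom-unfold μ (suc k) ⟩
    factℚ (2 ℕ.* μ ℕ.+ 4 ℕ.* suc k ℕ.+ 1) * invFact (+ (2 ℕ.* suc k ℕ.+ 1)) * invFact (+ (μ ℕ.+ 2 ℕ.* suc k)) * Iμ
      ≡⟨ cong₃ (λ x y z → factℚ x * invFact (+ y) * invFact (+ z) * Iμ)
               (numerator-shift μ k) (first-denominator-shift k) (second-denominator-shift μ k) ⟩
    factℚ (suc (suc (suc (suc f)))) * Ia * Ib * Iμ
      ≡⟨ cong (λ x → x * Ia * Ib * Iμ)
              (trans (factℚ-suc² (suc (suc f))) (cong ((ι⁺ (suc (suc f)) + 2) * (ι⁺ (suc (suc f)) + 1) *_) (factℚ-suc² f))) ⟩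
    (ι⁺ (suc (suc f)) + 2) * (ι⁺ (suc (suc f)) + 1) * ((ι⁺ f + 2) * (ι⁺ f + 1) * X) * Ia * Ib * Iμ
      ≡⟨ cong₂ (λ x y → (x + 2) * (x + 1) * ((y + 2) * (y + 1) * X) * Ia * Ib * Iμ) ⟦f+2⟧ ⟦f⟧ ⟩
    (2 * M + 4 * K + 3 + 2) * (2 * M + 4 * K + 3 + 1) * ((2 * M + 4 * K + 1 + 2) * (2 * M + 4 * K + 1 + 1) * X)
      * Ia * Ib * Iμ
      ≡⟨ regroup M K X Ia Ib Iμ ⟩
    (2 * M + 4 * K + 5) * (2 * M + 4 * K + 4) * (2 * M + 4 * K + 3) * (2 * M + 4 * K + 2) * common
      ∎
    where
    open ≡-Reasoning
    ⟦f⟧ : ι⁺ (2 ℕ.* μ ℕ.+ 4 ℕ.* k ℕ.+ 1) ≡ 2 * M + 4 * K + 1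
    ⟦f⟧ = ι⁺-linear 2 4 1 μ k refl
    ⟦f+2⟧ : ι⁺ (suc (suc (2 ℕ.* μ ℕ.+ 4 ℕ.* k ℕ.+ 1))) ≡ 2 * M + 4 * K + 3
    ⟦f+2⟧ = ι⁺-linear 2 4 3 μ k (normal-form μ k)
      where
      normal-form : ∀ μ k → suc (suc (2 ℕ.* μ ℕ.+ 4 ℕ.* k ℕ.+ 1)) ≡ 2 ℕ.* μ ℕ.+ 4 ℕ.* k ℕ.+ 3
      normal-form = ℕ-Solver.solve-∀
    numerator-shift : ∀ μ k → 2 ℕ.* μ ℕ.+ 4 ℕ.* suc k ℕ.+ 1 ≡ suc (suc (suc (suc (2 ℕ.* μ ℕ.+ 4 ℕ.* k ℕ.+ 1))))
    numerator-shift = ℕ-Solver.solve-∀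
    first-denominator-shift : ∀ k → 2 ℕ.* suc k ℕ.+ 1 ≡ suc (suc (2 ℕ.* k ℕ.+ 1))
    first-denominator-shift = ℕ-Solver.solve-∀
    second-denominator-shift : ∀ μ k → μ ℕ.+ 2 ℕ.* suc k ≡ suc (suc (μ ℕ.+ 2 ℕ.* k))
    second-denominator-shift = ℕ-Solver.solve-∀
    regroup : ∀ M K X Ia Ib Iμ →
      (2 * M + 4 * K + 3 + 2) * (2 * M + 4 * K + 3 + 1) * ((2 * M + 4 * K + 1 + 2) * (2 * M + 4 * K + 1 + 1) * X)
        * Ia * Ib * Iμ
        ≡ (2 * M + 4 * K + 5) * (2 * M + 4 * K + 4) * (2 * M + 4 * K + 3) * (2 * M + 4 * K + 2) * (X * Ia * Ib * Iμ)
    regroup M K X Ia Ib Iμ = solve (M ∷ K ∷ X ∷ Ia ∷ Ib ∷ Iμ ∷ []) ℚ-ring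

  step : MultinomStepInν (μ ℕ.+ k) μ
  step = begin
    2 * (4 * ι⁺ (μ ℕ.+ k) - 2 * M + 5) * (4 * ι⁺ (μ ℕ.+ k) - 2 * M + 3) * multinom (μ ℕ.+ k) μ
      ≡⟨ cong₂ (λ N A → 2 * (4 * N - 2 * M + 5) * (4 * N - 2 * M + 3) * A) (ι⁺-+ μ k) lower ⟩
    2 * (4 * (M + K) - 2 * M + 5) * (4 * (M + K) - 2 * M + 3)
      * ((2 * K + 2) * (2 * K + 3) * (M + 2 * K + 1) * (M + 2 * K + 2) * common)
      ≡⟨ identity M K common ⟩
    (2 * (M + K - M) + 3) * (M + K - M + 1)
      * ((2 * M + 4 * K + 5) * (2 * M + 4 * K + 4) * (2 * M + 4 * K + 3) * (2 * M + 4 * K + 2) * common)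
      ≡⟨ cong₂ (λ N B → (2 * (N - M) + 3) * (N - M + 1) * B) (ι⁺-+ μ k) upper ⟨
    (2 * (ι⁺ (μ ℕ.+ k) - M) + 3) * (ι⁺ (μ ℕ.+ k) - M + 1) * multinom (suc (μ ℕ.+ k)) μ
      ∎
    where
    open ≡-Reasoning
    identity : ∀ M K W →
      2 * (4 * (M + K) - 2 * M + 5) * (4 * (M + K) - 2 * M + 3)
        * ((2 * K + 2) * (2 * K + 3) * (M + 2 * K + 1) * (M + 2 * K + 2) * W)
        ≡ (2 * (M + K - M) + 3) * (M + K - M + 1)
        * ((2 * M + 4 * K + 5) * (2 * M + 4 * K + 4) * (2 * M + 4 * K + 3) * (2 * M + 4 * K + 2) * W)
    identity M K W = solve (M ∷ K ∷ W ∷ []) ℚ-ring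

multinom-step-ν-at-top : ∀ ν → MultinomStepInν ν (suc ν)
multinom-step-ν-at-top ν = begin
  c * multinom ν (suc ν)                               ≡⟨ cong (c *_) (multinom-beyond ν) ⟩
  c * 0                                                ≡⟨ ℚ.*-zeroʳ c ⟩
  0                                                    ≡⟨ vanishing N (multinom (suc ν) (suc ν)) ⟨
  (2 * (N - (N + 1)) + 3) * (N - (N + 1) + 1) * multinom (suc ν) (suc ν)
    ≡⟨ cong (λ x → (2 * (N - x) + 3) * (N - x + 1) * multinom (suc ν) (suc ν)) (ι⁺-suc ν) ⟨
  (2 * (N - ι⁺ (suc ν)) + 3) * (N - ι⁺ (suc ν) + 1) * multinom (suc ν) (suc ν) ∎
  where
  open ≡-Reasoning
  N = ι⁺ ν
  c = 2 * (4 * N - 2 * ι⁺ (suc ν) + 5) * (4 * N - 2 * ι⁺ (suc ν) + 3)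
  vanishing : ∀ N A → (2 * (N - (N + 1)) + 3) * (N - (N + 1) + 1) * A ≡ 0
  vanishing N A = solve (N ∷ A ∷ []) ℚ-ring

multinom-step-ν : ∀ ν μ → μ ℕ.≤ suc ν → MultinomStepInν ν μ
multinom-step-ν ν μ μ≤1+ν =
  compare-cases (λ μ n → μ ℕ.≤ n → MultinomStepInν (ℕ.pred n) μ)
    (λ μ k _ → MultinomNeighboursInν.step μ k)
    (λ { zero _ → MultinomNeighboursInν.step 0 0 ; (suc ν) _ → multinom-step-ν-at-top ν })  -- only n = suc ν occurs
    (λ n k μ≤n → contradiction μ≤n (ℕ.<⇒≱ (ℕ.s≤s (ℕ.m≤m+n n k))))
    μ (suc ν) μ≤1+ν

summand : ℕ → ℕ → ℕ → ℚ
summand ν j μ = signPow μ * oddRecip (+ j ℤ.- + μ) * multinom ν μ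

lhs : ℕ → ℕ → ℚ
lhs ν j = ∑ (suc ν) (summand ν j)

Q₀ Q₁ : ℕ → ℕ → ℚ
Q₀ ν j = 2 * (ι⁺ ν - ι⁺ j) * (2 * ι⁺ ν - 2 * ι⁺ j - 1)
Q₁ ν j = 2 * (2 * ι⁺ ν - ι⁺ j) * (2 * ι⁺ j + 3)

jCertificate : ℕ → ℕ → ℕ → ℚ
jCertificate ν j μ =
  - (2 * ι⁺ μ * (4 * ι⁺ ν - 2 * ι⁺ μ + 3)) * signPow μ * multinom ν μ * oddRecip (+ suc j ℤ.- + μ)

telescoping-identity-in-j : ∀ N J M s A C r₀ r₁ →
  (2 * (N - M) + 1) * (N - M) * A ≡ (M + 1) * (4 * N - 2 * M + 1) * C →
  r₀ * (2 * (J - M) + 1) ≡ 1 → r₁ * (2 * (J + 1 - M) + 1) ≡ 1 →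
  2 * (N - J) * (2 * N - 2 * J - 1) * (s * r₀ * A) + 2 * (2 * N - J) * (2 * J + 3) * (s * r₁ * A)
    ≡ - (2 * (M + 1) * (4 * N - 2 * (M + 1) + 3)) * - s * C * r₀ - - (2 * M * (4 * N - 2 * M + 3)) * s * A * r₁
telescoping-identity-in-j N J M s A C r₀ r₁ hA h₀ h₁ =
  let d₀ = 2 * (J - M) + 1
      d₁ = 2 * (J + 1 - M) + 1
  in *-cancelˡ-invertible (r₀ * r₁) (d₀ * d₁) (inverse-* {r₀} {r₁} {d₀} {d₁} h₀ h₁) (begin
  d₀ * d₁ * (2 * (N - J) * (2 * N - 2 * J - 1) * (s * r₀ * A) + 2 * (2 * N - J) * (2 * J + 3) * (s * r₁ * A))
    ≡⟨ solve (N ∷ J ∷ M ∷ s ∷ A ∷ r₀ ∷ r₁ ∷ []) ℚ-ring ⟩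
  s * A * (2 * (N - J) * (2 * N - 2 * J - 1) * d₁ * (r₀ * d₀) + 2 * (2 * N - J) * (2 * J + 3) * d₀ * (r₁ * d₁))
    ≡⟨ cong₂ (λ x y → s * A * (2 * (N - J) * (2 * N - 2 * J - 1) * d₁ * x + 2 * (2 * N - J) * (2 * J + 3) * d₀ * y)) h₀ h₁ ⟩
  s * A * (2 * (N - J) * (2 * N - 2 * J - 1) * d₁ * 1 + 2 * (2 * N - J) * (2 * J + 3) * d₀ * 1)
    ≡⟨ solve (N ∷ J ∷ M ∷ s ∷ A ∷ []) ℚ-ring ⟩
  2 * s * d₁ * ((2 * (N - M) + 1) * (N - M) * A) * 1 + 2 * M * (4 * N - 2 * M + 3) * s * A * d₀ * 1
    ≡⟨ cong₃ (λ x y z → 2 * s * d₁ * x * y + 2 * M * (4 * N - 2 * M + 3) * s * A * d₀ * z) hA (sym h₀) (sym h₁) ⟩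
  2 * s * d₁ * ((M + 1) * (4 * N - 2 * M + 1) * C) * (r₀ * d₀) + 2 * M * (4 * N - 2 * M + 3) * s * A * d₀ * (r₁ * d₁)
    ≡⟨ solve (N ∷ J ∷ M ∷ s ∷ A ∷ C ∷ r₀ ∷ r₁ ∷ []) ℚ-ring ⟩
  d₀ * d₁ * (- (2 * (M + 1) * (4 * N - 2 * (M + 1) + 3)) * - s * C * r₀ - - (2 * M * (4 * N - 2 * M + 3)) * s * A * r₁)
    ∎)
  where open ≡-Reasoning

summand-telescopes-in-j : ∀ ν j μ → μ ℕ.≤ ν →
  Q₀ ν j * summand ν j μ + Q₁ ν j * summand ν (suc j) μ ≡ jCertificate ν j (suc μ) - jCertificate ν j μ
summand-telescopes-in-j ν j μ μ≤ν = begin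
  Q₀ ν j * summand ν j μ + Q₁ ν j * summand ν (suc j) μ
    ≡⟨ telescoping-identity-in-j N (ι⁺ j) M s (multinom ν μ) (multinom ν (suc μ))
                                 (oddRecip (+ j ℤ.- + μ)) (oddRecip (+ suc j ℤ.- + μ))
                                 (multinom-step-μ ν μ μ≤ν) (oddRecip-difference j μ) r₁-inverse ⟩
  - (2 * (M + 1) * (4 * N - 2 * (M + 1) + 3)) * - s * multinom ν (suc μ) * oddRecip (+ j ℤ.- + μ)
    - - (2 * M * (4 * N - 2 * M + 3)) * s * multinom ν μ * oddRecip (+ suc j ℤ.- + μ)
    ≡⟨ cong₂ (λ x r → - (2 * x * (4 * N - 2 * x + 3)) * - s * multinom ν (suc μ) * oddRecip r - jCertificate ν j μ)
             (ι⁺-suc μ) ([+1+m]-[+1+n]≡[+m]-[+n] j μ) ⟨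
  jCertificate ν j (suc μ) - jCertificate ν j μ ∎
  where
  open ≡-Reasoning
  N = ι⁺ ν
  M = ι⁺ μ
  s = signPow μ
  r₁-inverse : oddRecip (+ suc j ℤ.- + μ) * (2 * (ι⁺ j + 1 - M) + 1) ≡ 1
  r₁-inverse = trans (cong (λ x → oddRecip (+ suc j ℤ.- + μ) * (2 * (x - M) + 1)) (sym (ι⁺-suc j)))
                     (oddRecip-difference (suc j) μ)

lhs-recurrence-in-j : ∀ ν j → Q₀ ν j * lhs ν j + Q₁ ν j * lhs ν (suc j) ≡ 0
lhs-recurrence-in-j ν j = begin
  Q₀ ν j * lhs ν j + Q₁ ν j * lhs ν (suc j)
    ≡⟨ ∑-telescoping (suc ν) {Q₀ ν j} {Q₁ ν j} {summand ν j} {summand ν (suc j)} {jCertificate ν j}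
                     (λ μ μ<1+ν → summand-telescopes-in-j ν j μ (ℕ.≤-pred μ<1+ν)) ⟩
  jCertificate ν j (suc ν) - jCertificate ν j 0
    ≡⟨ cong₂ _-_ certificate-beyond certificate-at-0 ⟩
  0 - 0
    ≡⟨⟩
  0 ∎
  where
  open ≡-Reasoning
  certificate-beyond : jCertificate ν j (suc ν) ≡ 0
  certificate-beyond = trans (cong (λ A → c * signPow (suc ν) * A * oddRecip (+ suc j ℤ.- + suc ν)) (multinom-beyond ν))
               (absorb c (signPow (suc ν)) (oddRecip (+ suc j ℤ.- + suc ν)))
    where
    c = - (2 * ι⁺ (suc ν) * (4 * ι⁺ ν - 2 * ι⁺ (suc ν) + 3))
    absorb : ∀ c s r → c * s * 0 * r ≡ 0
    absorb c s r = solve (c ∷ s ∷ r ∷ []) ℚ-ring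
  certificate-at-0 : jCertificate ν j 0 ≡ 0
  certificate-at-0 = absorb (ι⁺ ν) (signPow 0) (multinom ν 0) (oddRecip (+ suc j ℤ.- + 0))
    where
    absorb : ∀ N s A r → - (2 * 0 * (4 * N - 2 * 0 + 3)) * s * A * r ≡ 0
    absorb N s A r = solve (N ∷ s ∷ A ∷ r ∷ []) ℚ-ring

rhs : ℕ → ℕ → ℚ
rhs ν j = signPow j * twoPow (4 ℕ.* ν) * factℚ (2 ℕ.* ν ℕ.∸ j) * factℚ j
        * invFact (+ 2 ℤ.* (+ ν ℤ.- + j)) * invFact (+ (2 ℕ.* j ℕ.+ 1))

rhs-beyond : ∀ ν m → rhs ν (ν ℕ.+ suc m) ≡ 0
rhs-beyond ν m = trans (cong (λ x → c * invFact (+ 2 ℤ.* x) * invFact (+ (2 ℕ.* j ℕ.+ 1))) ([+m]-[+m+1+n]≡-[1+n] ν m))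
                       (absorb c (invFact (+ (2 ℕ.* j ℕ.+ 1))))
  where
  j = ν ℕ.+ suc m
  c = signPow j * twoPow (4 ℕ.* ν) * factℚ (2 ℕ.* ν ℕ.∸ j) * factℚ j
  absorb : ∀ c I → c * 0 * I ≡ 0
  absorb c I = solve (c ∷ I ∷ []) ℚ-ring

module RhsNeighboursInj (j d : ℕ) where

  private
    J = ι⁺ j
    D = ι⁺ d
    s = signPow j
    T = twoPow (4 ℕ.* suc (j ℕ.+ d))
    e = j ℕ.+ 2 ℕ.* d ℕ.+ 1
    Id = invFact (+ suc (suc (2 ℕ.* d)))
    Ij = invFact (+ suc (suc (2 ℕ.* j ℕ.+ 1)))

  common : ℚ
  common = T * factℚ e * factℚ j * Id * Ij

  lower : rhs (suc (j ℕ.+ d)) j ≡ s * (J + 2 * D + 2) * (2 * J + 2) * (2 * J + 3) * common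
  lower = begin
    rhs (suc (j ℕ.+ d)) j
      ≡⟨ cong₂ (λ x y → s * T * factℚ x * factℚ j * invFact y * invFact (+ (2 ℕ.* j ℕ.+ 1))) 2ν∸j 2[ν-j] ⟩
    s * T * factℚ (suc e) * factℚ j * Id * invFact (+ (2 ℕ.* j ℕ.+ 1))
      ≡⟨ cong₂ (λ x y → s * T * x * factℚ j * Id * y) (factℚ-suc e) (invFact-suc² (2 ℕ.* j ℕ.+ 1)) ⟩
    s * T * ((ι⁺ e + 1) * factℚ e) * factℚ j * Id * ((ι⁺ (2 ℕ.* j ℕ.+ 1) + 1) * (ι⁺ (2 ℕ.* j ℕ.+ 1) + 2) * Ij)
      ≡⟨ cong₂ (λ x y → s * T * ((x + 1) * factℚ e) * factℚ j * Id * ((y + 1) * (y + 2) * Ij)) ⟦e⟧ ⟦2j+1⟧ ⟩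
    s * T * ((J + 2 * D + 1 + 1) * factℚ e) * factℚ j * Id * ((2 * J + 1 + 1) * (2 * J + 1 + 2) * Ij)
      ≡⟨ regroup J D s T (factℚ e) (factℚ j) Id Ij ⟩
    s * (J + 2 * D + 2) * (2 * J + 2) * (2 * J + 3) * common
      ∎
    where
    open ≡-Reasoning
    2ν∸j : 2 ℕ.* suc (j ℕ.+ d) ℕ.∸ j ≡ suc e
    2ν∸j = trans (cong (ℕ._∸ j) (split j d)) (ℕ.m+n∸m≡n j (suc e))
      where
      split : ∀ j d → 2 ℕ.* suc (j ℕ.+ d) ≡ j ℕ.+ suc (j ℕ.+ 2 ℕ.* d ℕ.+ 1)
      split = ℕ-Solver.solve-∀
    2[ν-j] : + 2 ℤ.* (+ suc (j ℕ.+ d) ℤ.- + j) ≡ + suc (suc (2 ℕ.* d))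
    2[ν-j] = begin
      + 2 ℤ.* (+ suc (j ℕ.+ d) ℤ.- + j)  ≡⟨ cong (λ x → + 2 ℤ.* (+ x ℤ.- + j)) (ℕ.+-suc j d) ⟨
      + 2 ℤ.* (+ (j ℕ.+ suc d) ℤ.- + j)  ≡⟨ cong (+ 2 ℤ.*_) ([+m+n]-[+m]≡+n j (suc d)) ⟩
      + 2 ℤ.* + suc d                    ≡⟨ ℤ.pos-* 2 (suc d) ⟨
      + (2 ℕ.* suc d)                    ≡⟨ cong +_ (ℕ.*-suc 2 d) ⟩
      + suc (suc (2 ℕ.* d))              ∎
    ⟦e⟧ : ι⁺ (j ℕ.+ 2 ℕ.* d ℕ.+ 1) ≡ J + 2 * D + 1
    ⟦e⟧ = trans (ι⁺-+ (j ℕ.+ 2 ℕ.* d) 1) (cong (_+ 1) (trans (ι⁺-+ j (2 ℕ.* d)) (cong (λ x → J + x) (ι⁺-* 2 d))))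
    ⟦2j+1⟧ : ι⁺ (2 ℕ.* j ℕ.+ 1) ≡ 2 * J + 1
    ⟦2j+1⟧ = trans (ι⁺-+ (2 ℕ.* j) 1) (cong (_+ 1) (ι⁺-* 2 j))
    regroup : ∀ J D s T Fe Fj Id Ij →
      s * T * ((J + 2 * D + 1 + 1) * Fe) * Fj * Id * ((2 * J + 1 + 1) * (2 * J + 1 + 2) * Ij)
        ≡ s * (J + 2 * D + 2) * (2 * J + 2) * (2 * J + 3) * (T * Fe * Fj * Id * Ij)
    regroup J D s T Fe Fj Id Ij = solve (J ∷ D ∷ s ∷ T ∷ Fe ∷ Fj ∷ Id ∷ Ij ∷ []) ℚ-ring

  upper : rhs (suc (j ℕ.+ d)) (suc j) ≡ - s * (J + 1) * (2 * D + 1) * (2 * D + 2) * common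
  upper = begin
    rhs (suc (j ℕ.+ d)) (suc j)
      ≡⟨ cong₃ (λ x y z → - s * T * factℚ x * factℚ (suc j) * invFact y * invFact (+ z)) 2ν∸[1+j] 2[ν-1-j] 2[1+j]+1 ⟩
    - s * T * factℚ e * factℚ (suc j) * invFact (+ (2 ℕ.* d)) * Ij
      ≡⟨ cong₂ (λ x y → - s * T * factℚ e * x * y * Ij) (factℚ-suc j) (invFact-suc² (2 ℕ.* d)) ⟩
    - s * T * factℚ e * ((J + 1) * factℚ j) * ((ι⁺ (2 ℕ.* d) + 1) * (ι⁺ (2 ℕ.* d) + 2) * Id) * Ij
      ≡⟨ cong (λ x → - s * T * factℚ e * ((J + 1) * factℚ j) * ((x + 1) * (x + 2) * Id) * Ij) (ι⁺-* 2 d) ⟩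
    - s * T * factℚ e * ((J + 1) * factℚ j) * ((2 * D + 1) * (2 * D + 2) * Id) * Ij
      ≡⟨ regroup J D s T (factℚ e) (factℚ j) Id Ij ⟩
    - s * (J + 1) * (2 * D + 1) * (2 * D + 2) * common
      ∎
    where
    open ≡-Reasoning
    2ν∸[1+j] : 2 ℕ.* suc (j ℕ.+ d) ℕ.∸ suc j ≡ e
    2ν∸[1+j] = trans (cong (ℕ._∸ suc j) (split j d)) (ℕ.m+n∸m≡n (suc j) e)
      where
      split : ∀ j d → 2 ℕ.* suc (j ℕ.+ d) ≡ suc j ℕ.+ (j ℕ.+ 2 ℕ.* d ℕ.+ 1)
      split = ℕ-Solver.solve-∀
    2[ν-1-j] : + 2 ℤ.* (+ suc (j ℕ.+ d) ℤ.- + suc j) ≡ + (2 ℕ.* d)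
    2[ν-1-j] = begin
      + 2 ℤ.* (+ suc (j ℕ.+ d) ℤ.- + suc j) ≡⟨ cong (+ 2 ℤ.*_) ([+1+m]-[+1+n]≡[+m]-[+n] (j ℕ.+ d) j) ⟩
      + 2 ℤ.* (+ (j ℕ.+ d) ℤ.- + j)         ≡⟨ cong (+ 2 ℤ.*_) ([+m+n]-[+m]≡+n j d) ⟩
      + 2 ℤ.* + d                           ≡⟨ ℤ.pos-* 2 d ⟨
      + (2 ℕ.* d)                           ∎
    2[1+j]+1 : 2 ℕ.* suc j ℕ.+ 1 ≡ suc (suc (2 ℕ.* j ℕ.+ 1))
    2[1+j]+1 = cong (ℕ._+ 1) (ℕ.*-suc 2 j)
    regroup : ∀ J D s T Fe Fj Id Ij →
      - s * T * Fe * ((J + 1) * Fj) * ((2 * D + 1) * (2 * D + 2) * Id) * Ij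
        ≡ - s * (J + 1) * (2 * D + 1) * (2 * D + 2) * (T * Fe * Fj * Id * Ij)
    regroup J D s T Fe Fj Id Ij = solve (J ∷ D ∷ s ∷ T ∷ Fe ∷ Fj ∷ Id ∷ Ij ∷ []) ℚ-ring

  recurrence : Q₀ (suc (j ℕ.+ d)) j * rhs (suc (j ℕ.+ d)) j + Q₁ (suc (j ℕ.+ d)) j * rhs (suc (j ℕ.+ d)) (suc j) ≡ 0
  recurrence = begin
    Q₀ (suc (j ℕ.+ d)) j * rhs (suc (j ℕ.+ d)) j + Q₁ (suc (j ℕ.+ d)) j * rhs (suc (j ℕ.+ d)) (suc j)
      ≡⟨ cong₃ (λ N x y → 2 * (N - J) * (2 * N - 2 * J - 1) * x + 2 * (2 * N - J) * (2 * J + 3) * y) ⟦ν⟧ lower upper ⟩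
    2 * (J + D + 1 - J) * (2 * (J + D + 1) - 2 * J - 1) * (s * (J + 2 * D + 2) * (2 * J + 2) * (2 * J + 3) * common)
      + 2 * (2 * (J + D + 1) - J) * (2 * J + 3) * (- s * (J + 1) * (2 * D + 1) * (2 * D + 2) * common)
      ≡⟨ identity J D s common ⟩
    0 ∎
    where
    open ≡-Reasoning
    ⟦ν⟧ : ι⁺ (suc (j ℕ.+ d)) ≡ J + D + 1
    ⟦ν⟧ = trans (ι⁺-suc (j ℕ.+ d)) (cong (_+ 1) (ι⁺-+ j d))
    identity : ∀ J D s Z →
      2 * (J + D + 1 - J) * (2 * (J + D + 1) - 2 * J - 1) * (s * (J + 2 * D + 2) * (2 * J + 2) * (2 * J + 3) * Z)
        + 2 * (2 * (J + D + 1) - J) * (2 * J + 3) * (- s * (J + 1) * (2 * D + 1) * (2 * D + 2) * Z) ≡ 0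
    identity J D s Z = solve (J ∷ D ∷ s ∷ Z ∷ []) ℚ-ring

rhs-recurrence-at-top : ∀ ν → Q₀ ν ν * rhs ν ν + Q₁ ν ν * rhs ν (suc ν) ≡ 0
rhs-recurrence-at-top ν = begin
  Q₀ ν ν * rhs ν ν + Q₁ ν ν * rhs ν (suc ν)
    ≡⟨ cong (λ x → Q₀ ν ν * rhs ν ν + Q₁ ν ν * x) (trans (cong (rhs ν) (ℕ.+-comm 1 ν)) (rhs-beyond ν 0)) ⟩
  Q₀ ν ν * rhs ν ν + Q₁ ν ν * 0
    ≡⟨ vanishing (ι⁺ ν) (rhs ν ν) (Q₁ ν ν) ⟩
  0 ∎
  where
  open ≡-Reasoning
  vanishing : ∀ N R q → 2 * (N - N) * (2 * N - 2 * N - 1) * R + q * 0 ≡ 0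
  vanishing N R q = solve (N ∷ R ∷ q ∷ []) ℚ-ring

rhs-recurrence-beyond-top : ∀ ν m →
  Q₀ ν (suc (ν ℕ.+ m)) * rhs ν (suc (ν ℕ.+ m)) + Q₁ ν (suc (ν ℕ.+ m)) * rhs ν (suc (suc (ν ℕ.+ m))) ≡ 0
rhs-recurrence-beyond-top ν m = begin
  Q₀ ν j * rhs ν j + Q₁ ν j * rhs ν (suc j)
    ≡⟨ cong₂ (λ x y → Q₀ ν j * x + Q₁ ν j * y)
             (trans (cong (rhs ν) (sym (ℕ.+-suc ν m))) (rhs-beyond ν m))
             (trans (cong (rhs ν) (sym (trans (ℕ.+-suc ν (suc m)) (cong suc (ℕ.+-suc ν m))))) (rhs-beyond ν (suc m))) ⟩
  Q₀ ν j * 0 + Q₁ ν j * 0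
    ≡⟨ vanishing (Q₀ ν j) (Q₁ ν j) ⟩
  0 ∎
  where
  open ≡-Reasoning
  j = suc (ν ℕ.+ m)
  vanishing : ∀ a b → a * 0 + b * 0 ≡ 0
  vanishing a b = solve (a ∷ b ∷ []) ℚ-ring

rhs-recurrence-in-j : ∀ ν j → Q₀ ν j * rhs ν j + Q₁ ν j * rhs ν (suc j) ≡ 0
rhs-recurrence-in-j ν j =
  compare-cases (λ j ν → Q₀ ν j * rhs ν j + Q₁ ν j * rhs ν (suc j) ≡ 0)
    RhsNeighboursInj.recurrence (λ ν → rhs-recurrence-at-top ν) (λ ν m → rhs-recurrence-beyond-top ν m) j ν

νCoefficient : ℕ → ℚ
νCoefficient n = (ι⁺ n + 1) * (2 * ι⁺ n + 1) * (2 * ι⁺ n + 3)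

νCertificate : ℕ → ℕ → ℚ
νCertificate n μ = signPow μ * multinom (suc n) μ
  * (ι⁺ μ * ((12 * ι⁺ n + 14) * ι⁺ μ - (16 * ι⁺ n * ι⁺ n + 38 * ι⁺ n + 23))) * oddRecip (+ μ ℤ.- + (2 ℕ.* n ℕ.+ 3))

telescoping-identity-in-ν : ∀ N M s A B C r₀ r₁ r₂ →
  2 * (4 * N - 2 * M + 5) * (4 * N - 2 * M + 3) * A ≡ (2 * (N - M) + 3) * (N - M + 1) * B →
  (2 * (N + 1 - M) + 1) * (N + 1 - M) * B ≡ (M + 1) * (4 * (N + 1) - 2 * M + 1) * C →
  r₀ * (2 * (0 - M) + 1) ≡ 1 → r₁ * (2 * (M + 1 - (2 * N + 3)) + 1) ≡ 1 → r₂ * (2 * (M - (2 * N + 3)) + 1) ≡ 1 →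
  (N + 1) * (2 * N + 1) * (2 * N + 3) * (s * r₀ * B) + - (16 * ((N + 1) * (2 * N + 1) * (2 * N + 3))) * (s * r₀ * A)
    ≡ - s * C * ((M + 1) * ((12 * N + 14) * (M + 1) - (16 * N * N + 38 * N + 23))) * r₁
      - s * B * (M * ((12 * N + 14) * M - (16 * N * N + 38 * N + 23))) * r₂
telescoping-identity-in-ν N M s A B C r₀ r₁ r₂ hA hC h₀ h₁ h₂ =
  let d₀ = 2 * (0 - M) + 1
      d₁ = 2 * (M + 1 - (2 * N + 3)) + 1
      d₂ = 2 * (M - (2 * N + 3)) + 1
      D  = (N + 1) * (2 * N + 1) * (2 * N + 3)
      X₁ = (12 * N + 14) * (M + 1) - (16 * N * N + 38 * N + 23)
      X₀ = M * ((12 * N + 14) * M - (16 * N * N + 38 * N + 23))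
  in *-cancelˡ-invertible (r₀ * r₁ * r₂) (d₀ * d₁ * d₂)
       (inverse-* {r₀ * r₁} {r₂} {d₀ * d₁} {d₂} (inverse-* {r₀} {r₁} {d₀} {d₁} h₀ h₁) h₂) (begin
  d₀ * d₁ * d₂ * (D * (s * r₀ * B) + - (16 * D) * (s * r₀ * A))
    ≡⟨ solve (N ∷ M ∷ s ∷ A ∷ B ∷ r₀ ∷ []) ℚ-ring ⟩
  s * D * d₁ * d₂ * B * (r₀ * d₀) - 8 * s * D * (r₀ * d₀) * (2 * (4 * N - 2 * M + 5) * (4 * N - 2 * M + 3) * A)
    ≡⟨ cong₂ (λ x y → s * D * d₁ * d₂ * B * x - 8 * s * D * x * y) h₀ hA ⟩
  s * D * d₁ * d₂ * B * 1 - 8 * s * D * 1 * ((2 * (N - M) + 3) * (N - M + 1) * B)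
    ≡⟨ solve (N ∷ M ∷ s ∷ B ∷ []) ℚ-ring ⟩
  s * d₀ * X₁ * 1 * ((2 * (N + 1 - M) + 1) * (N + 1 - M) * B) - s * B * d₀ * d₁ * X₀ * 1
    ≡⟨ cong₃ (λ x y z → s * d₀ * X₁ * x * y - s * B * d₀ * d₁ * X₀ * z) (sym h₁) hC (sym h₂) ⟩
  s * d₀ * X₁ * (r₁ * d₁) * ((M + 1) * (4 * (N + 1) - 2 * M + 1) * C) - s * B * d₀ * d₁ * X₀ * (r₂ * d₂)
    ≡⟨ solve (N ∷ M ∷ s ∷ B ∷ C ∷ r₁ ∷ r₂ ∷ []) ℚ-ring ⟩
  d₀ * d₁ * d₂ * (- s * C * ((M + 1) * X₁) * r₁ - s * B * X₀ * r₂)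
    ∎)
  where open ≡-Reasoning

summand-telescopes-in-ν : ∀ n μ → μ ℕ.≤ suc n →
  νCoefficient n * summand (suc n) 0 μ + - (16 * νCoefficient n) * summand n 0 μ
    ≡ νCertificate n (suc μ) - νCertificate n μ
summand-telescopes-in-ν n μ μ≤1+n = begin
  νCoefficient n * summand (suc n) 0 μ + - (16 * νCoefficient n) * summand n 0 μ
    ≡⟨ telescoping-identity-in-ν N M s (multinom n μ) (multinom (suc n) μ) C (oddRecip (+ 0 ℤ.- + μ)) r₁ r₂
                         (multinom-step-ν n μ μ≤1+n) next-step (oddRecip-difference 0 μ) r₁-inverse r₂-inverse ⟩
  - s * C * ((M + 1) * ((12 * N + 14) * (M + 1) - (16 * N * N + 38 * N + 23))) * r₁ - νCertificate n μ
    ≡⟨ cong (λ x → - s * C * (x * ((12 * N + 14) * x - (16 * N * N + 38 * N + 23))) * r₁ - νCertificate n μ)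
            (ι⁺-suc μ) ⟨
  νCertificate n (suc μ) - νCertificate n μ ∎
  where
  open ≡-Reasoning
  N = ι⁺ n
  M = ι⁺ μ
  s = signPow μ
  C = multinom (suc n) (suc μ)
  r₁ = oddRecip (+ suc μ ℤ.- + (2 ℕ.* n ℕ.+ 3))
  r₂ = oddRecip (+ μ ℤ.- + (2 ℕ.* n ℕ.+ 3))
  next-step : (2 * (N + 1 - M) + 1) * (N + 1 - M) * multinom (suc n) μ ≡ (M + 1) * (4 * (N + 1) - 2 * M + 1) * C
  next-step = subst (λ x → (2 * (x - M) + 1) * (x - M) * multinom (suc n) μ ≡ (M + 1) * (4 * x - 2 * M + 1) * C)
                    (ι⁺-suc n) (multinom-step-μ (suc n) μ μ≤1+n)
  ⟦2n+3⟧ : ι⁺ (2 ℕ.* n ℕ.+ 3) ≡ 2 * N + 3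
  ⟦2n+3⟧ = trans (ι⁺-+ (2 ℕ.* n) 3) (cong (_+ 3) (ι⁺-* 2 n))
  r₁-inverse : r₁ * (2 * (M + 1 - (2 * N + 3)) + 1) ≡ 1
  r₁-inverse = trans (sym (cong₂ (λ x y → r₁ * (2 * (x - y) + 1)) (ι⁺-suc μ) ⟦2n+3⟧))
                     (oddRecip-difference (suc μ) (2 ℕ.* n ℕ.+ 3))
  r₂-inverse : r₂ * (2 * (M - (2 * N + 3)) + 1) ≡ 1
  r₂-inverse = trans (cong (λ y → r₂ * (2 * (M - y) + 1)) (sym ⟦2n+3⟧)) (oddRecip-difference μ (2 ℕ.* n ℕ.+ 3))

νCoefficient-inverse : ∀ n → (+ 1 / suc n) * oddRecip (+ n) * oddRecip (+ suc n) * νCoefficient n ≡ 1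
νCoefficient-inverse n =
  inverse-* {(+ 1 / suc n) * oddRecip (+ n)} {oddRecip (+ suc n)} {(N + 1) * (2 * N + 1)} {2 * N + 3}
    (inverse-* {+ 1 / suc n} {oddRecip (+ n)} {N + 1} {2 * N + 1}
      (trans (cong ((+ 1 / suc n) *_) (sym (ι⁺-suc n))) (ι⁺-inverse (suc n)))
      (oddRecip-inverse (+ n)))
    (trans (cong (oddRecip (+ suc n) *_) (trans (shift N) (cong (λ x → 2 * x + 1) (sym (ι⁺-suc n)))))
           (oddRecip-inverse (+ suc n)))
  where
  N = ι⁺ n
  shift : ∀ N → 2 * N + 3 ≡ 2 * (N + 1) + 1
  shift N = solve (N ∷ []) ℚ-ring

lhs-recurrence-in-ν : ∀ n → lhs (suc n) 0 ≡ 16 * lhs n 0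
lhs-recurrence-in-ν n =
  *-cancelˡ-invertible ((+ 1 / suc n) * oddRecip (+ n) * oddRecip (+ suc n)) D (νCoefficient-inverse n)
    (x∙y⁻¹≈ε⇒x≈y (D * lhs (suc n) 0) (D * (16 * lhs n 0)) (begin
  D * lhs (suc n) 0 + - (D * (16 * lhs n 0))
    ≡⟨ regroup D (lhs (suc n) 0) (lhs n 0) ⟩
  D * lhs (suc n) 0 + - (16 * D) * (lhs n 0 + 0)
    ≡⟨ cong (λ z → D * lhs (suc n) 0 + - (16 * D) * (lhs n 0 + z)) last-summand ⟨
  D * ∑ (suc (suc n)) (summand (suc n) 0) + - (16 * D) * ∑ (suc (suc n)) (summand n 0)
    ≡⟨ ∑-telescoping (suc (suc n)) {D} { - (16 * D)} {summand (suc n) 0} {summand n 0} {νCertificate n}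
                     (λ μ μ<2+n → summand-telescopes-in-ν n μ (ℕ.≤-pred μ<2+n)) ⟩
  νCertificate n (suc (suc n)) - νCertificate n 0
    ≡⟨ cong₂ _-_ certificate-beyond certificate-at-0 ⟩
  0 - 0
    ≡⟨⟩
  0 ∎))
  where
  open ≡-Reasoning
  D = νCoefficient n
  regroup : ∀ D X Y → D * X + - (D * (16 * Y)) ≡ D * X + - (16 * D) * (Y + 0)
  regroup D X Y = solve (D ∷ X ∷ Y ∷ []) ℚ-ring
  last-summand : summand n 0 (suc n) ≡ 0
  last-summand = trans (cong (signPow (suc n) * oddRecip (+ 0 ℤ.- + suc n) *_) (multinom-beyond n))
                       (ℚ.*-zeroʳ (signPow (suc n) * oddRecip (+ 0 ℤ.- + suc n)))
  certificate-beyond : νCertificate n (suc (suc n)) ≡ 0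
  certificate-beyond = trans (cong (λ A → signPow (suc (suc n)) * A * X * r) (multinom-beyond (suc n))) (absorb (signPow (suc (suc n))) X r)
    where
    X = ι⁺ (suc (suc n)) * ((12 * ι⁺ n + 14) * ι⁺ (suc (suc n)) - (16 * ι⁺ n * ι⁺ n + 38 * ι⁺ n + 23))
    r = oddRecip (+ suc (suc n) ℤ.- + (2 ℕ.* n ℕ.+ 3))
    absorb : ∀ s X r → s * 0 * X * r ≡ 0
    absorb s X r = solve (s ∷ X ∷ r ∷ []) ℚ-ring
  certificate-at-0 : νCertificate n 0 ≡ 0
  certificate-at-0 = absorb (ι⁺ n) (signPow 0) (multinom (suc n) 0) (oddRecip (+ 0 ℤ.- + (2 ℕ.* n ℕ.+ 3)))
    where
    absorb : ∀ N s A r → s * A * (0 * ((12 * N + 14) * 0 - (16 * N * N + 38 * N + 23))) * r ≡ 0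
    absorb N s A r = solve (N ∷ s ∷ A ∷ r ∷ []) ℚ-ring

twoPow-4*suc : ∀ n → twoPow (4 ℕ.* suc n) ≡ 16 * twoPow (4 ℕ.* n)
twoPow-4*suc n = begin
  ι⁺ (2 ℕ.^ (4 ℕ.* suc n))       ≡⟨ cong (λ m → ι⁺ (2 ℕ.^ m)) (ℕ.*-suc 4 n) ⟩
  ι⁺ (2 ℕ.^ (4 ℕ.+ 4 ℕ.* n))     ≡⟨ cong ι⁺ (ℕ.^-distribˡ-+-* 2 4 (4 ℕ.* n)) ⟩
  ι⁺ (16 ℕ.* 2 ℕ.^ (4 ℕ.* n))    ≡⟨ ι⁺-* 16 (2 ℕ.^ (4 ℕ.* n)) ⟩
  16 * ι⁺ (2 ℕ.^ (4 ℕ.* n))      ∎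
  where open ≡-Reasoning

lhs-at-0 : ∀ n → lhs n 0 ≡ twoPow (4 ℕ.* n)
lhs-at-0 zero    = refl
lhs-at-0 (suc n) = begin
  lhs (suc n) 0           ≡⟨ lhs-recurrence-in-ν n ⟩
  16 * lhs n 0            ≡⟨ cong (16 *_) (lhs-at-0 n) ⟩
  16 * twoPow (4 ℕ.* n)   ≡⟨ twoPow-4*suc n ⟨
  twoPow (4 ℕ.* suc n)    ∎
  where open ≡-Reasoning

rhs-at-0 : ∀ n → rhs n 0 ≡ twoPow (4 ℕ.* n)
rhs-at-0 n = begin
  rhs n 0                       ≡⟨ cong (λ x → 1 * T * F * 1 * invFact x * 1) 2[n-0]≡2n ⟩
  1 * T * F * 1 * I * 1         ≡⟨ regroup T F I ⟩
  T * (F * I)                   ≡⟨ cong (T *_) (factℚ*invFact (2 ℕ.* n)) ⟩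
  T * 1                         ≡⟨ ℚ.*-identityʳ T ⟩
  T                             ∎
  where
  open ≡-Reasoning
  T = twoPow (4 ℕ.* n)
  F = factℚ (2 ℕ.* n)
  I = invFact (+ (2 ℕ.* n))
  2[n-0]≡2n : + 2 ℤ.* (+ n ℤ.- + 0) ≡ + (2 ℕ.* n)
  2[n-0]≡2n = trans (cong (+ 2 ℤ.*_) (ℤ.+-identityʳ (+ n))) (sym (ℤ.pos-* 2 n))
  regroup : ∀ T F I → 1 * T * F * 1 * I * 1 ≡ T * (F * I)
  regroup T F I = solve (T ∷ F ∷ I ∷ []) ℚ-ring

Q₁-cancelˡ : ∀ ν j {x y} → suc j ℕ.≤ 2 ℕ.* ν → Q₁ ν j * x ≡ Q₁ ν j * y → x ≡ y
Q₁-cancelˡ ν j j<2ν with ℕ.m≤n⇒∃[o]m+o≡n j<2ν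
... | k , 1+j+k≡2ν = *-cancelˡ-invertible ((+ 1 / 2) * (+ 1 / suc k) * oddRecip (+ suc j)) (Q₁ ν j)
  (inverse-* {(+ 1 / 2) * (+ 1 / suc k)} {oddRecip (+ suc j)} {2 * (2 * N - J)} {2 * J + 3}
    (inverse-* {+ 1 / 2} {+ 1 / suc k} {2} {2 * N - J} refl
      (trans (cong ((+ 1 / suc k) *_) 2N-J≡1+K) (ι⁺-inverse (suc k))))
    (trans (cong (oddRecip (+ suc j) *_) 2J+3≡2[1+J]+1) (oddRecip-inverse (+ suc j))))
  where
  open ≡-Reasoning
  N = ι⁺ ν
  J = ι⁺ j
  2N-J≡1+K : 2 * N - J ≡ ι⁺ (suc k)
  2N-J≡1+K = begin
    2 * N - J                 ≡⟨ cong (_- J) (ι⁺-* 2 ν) ⟨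
    ι⁺ (2 ℕ.* ν) - J          ≡⟨ cong (λ x → ι⁺ x - J) (trans (sym 1+j+k≡2ν) (sym (ℕ.+-suc j k))) ⟩
    ι⁺ (j ℕ.+ suc k) - J      ≡⟨ cong (_- J) (ι⁺-+ j (suc k)) ⟩
    J + ι⁺ (suc k) - J        ≡⟨ cancel J (ι⁺ (suc k)) ⟩
    ι⁺ (suc k)                ∎
    where
    cancel : ∀ J X → J + X - J ≡ X
    cancel J X = solve (J ∷ X ∷ []) ℚ-ring
  2J+3≡2[1+J]+1 : 2 * J + 3 ≡ 2 * ι⁺ (suc j) + 1
  2J+3≡2[1+J]+1 = trans (shift J) (cong (λ x → 2 * x + 1) (sym (ι⁺-suc j)))
    where
    shift : ∀ J → 2 * J + 3 ≡ 2 * (J + 1) + 1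
    shift J = solve (J ∷ []) ℚ-ring

lhs≡rhs : ∀ ν j → j ℕ.≤ 2 ℕ.* ν → lhs ν j ≡ rhs ν j
lhs≡rhs ν zero    _    = trans (lhs-at-0 ν) (sym (rhs-at-0 ν))
lhs≡rhs ν (suc j) j<2ν = Q₁-cancelˡ ν j j<2ν (∙-cancelˡ (Q₀ ν j * rhs ν j) _ _ (begin
  Q₀ ν j * rhs ν j + Q₁ ν j * lhs ν (suc j)
    ≡⟨ cong (λ x → Q₀ ν j * x + Q₁ ν j * lhs ν (suc j)) (lhs≡rhs ν j (ℕ.<⇒≤ j<2ν)) ⟨
  Q₀ ν j * lhs ν j + Q₁ ν j * lhs ν (suc j)
    ≡⟨ lhs-recurrence-in-j ν j ⟩
  0
    ≡⟨ rhs-recurrence-in-j ν j ⟨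
  Q₀ ν j * rhs ν j + Q₁ ν j * rhs ν (suc j) ∎))
  where open ≡-Reasoning

lemma6p1 : (ν j : ℕ) → j ≤ 2 ℕ.* ν →
    sumTo ν (λ μ → signPow μ ℚ.* oddRecip (+ j ℤ.- + μ) ℚ.* multinom ν μ)
      ≡ signPow j ℚ.* twoPow (4 ℕ.* ν)
          ℚ.* factℚ (2 ℕ.* ν ℕ.∸ j) ℚ.* factℚ j
          ℚ.* invFact (+ 2 ℤ.* (+ ν ℤ.- + j))
          ℚ.* invFact (+ (2 ℕ.* j ℕ.+ 1))
lemma6p1 ν j j≤2ν = trans (sumTo≡∑ ν (summand ν j)) (lhs≡rhs ν j j≤2ν)
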